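{- $N(96) \ge 8$; that is, there exist $8$ mutually orthogonal Latin squares of order $96$.
   Context: A Latin square of order $n$ on an $n$-element set $V$ is an $n\times n$ matrix every row and every column of which is a permutation of $V$. Two Latin squares $L_1=(v_{ij})$ and $L_2=(w_{ij})$ of order $n$ (on symbol sets $V$, $W$ of size $n$) are orthogonal if the $n^2$ pairs $(v_{ij},w_{ij})$ are all distinct, i.e. they exhaust $V\times W$. A set of Latin squares is a set of mutually orthogonal Latin squares (MOLS) if any two of them are orthogonal. $N(n)$ denotes the largest size of a set of MOLS of order $n$. -}

module Defs where

open import Data.Nat using (ℕ)
open import Data.Fin using (Fin)
open import Data.Product using (_×_; _,_; Σ)
open import Relation.Binary.PropositionalEquality using (_≡_)
open import Relation.Nullary using (¬_)
open import Function.Definitions using (Bijective; Injective)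

IsLatinSquare : (n : ℕ) → (Fin n → Fin n → Fin n) → Set
IsLatinSquare n L =
  ((i : Fin n) → Bijective _≡_ _≡_ (λ j → L i j)) ×
  ((j : Fin n) → Bijective _≡_ _≡_ (λ i → L i j))

LatinSquare : ℕ → Set
LatinSquare n = Σ (Fin n → Fin n → Fin n) (IsLatinSquare n)

Orthogonal : {n : ℕ} → LatinSquare n → LatinSquare n → Set
Orthogonal {n} (L₁ , _) (L₂ , _) =
  Injective _≡_ _≡_ (λ (p : Fin n × Fin n) → let (i , j) = p in (L₁ i j , L₂ i j))

MOLS : ℕ → ℕ → Set
MOLS k n = Σ (Fin k → LatinSquare n)
             (λ F → (a b : Fin k) → ¬ (a ≡ b) → Orthogonal (F a) (F b))

{-# OPTIONS --safe #-}
-- The squares come from a difference matrix with 9 rows over Z₃ × Z₂⁵: an array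
-- D with 96 columns such that c ↦ D r c ∙ (D t c)⁻¹ is a bijection for any two
-- rows t ≠ r.  Translating its columns by the group gives an orthogonal array
-- with 9 + 1 rows, hence 8 MOLS.
--
-- The columns are indexed by pairs (s , v) with s among 12 base columns and
-- v ∈ Z₂³, and D r (s , v) = (b r s , c r s ⊕ Y r v) with Y r : Z₂³ → Z₂⁵
-- linear.  The Z₃-parts b form a difference matrix of index 4, and for each pair
-- of rows and each g ∈ Z₃ the four base columns with b r s − b t s = g must have
-- their differences c r s ⊕ c t s in the four cosets of the image of Y r ⊕ Y t.
module Submission where

open import Defs
open import Algebra.Bundles using (Group; CommutativeSemigroup)
open import Algebra.Structures using (IsGroup)
import Algebra.Properties.CommutativeSemigroup as CommutativeSemigroupProperties
import Algebra.Properties.Group as GroupProperties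
open import Data.Bool using (Bool; true; false; _xor_; if_then_else_)
import Data.Bool.Properties as Bool
open import Data.Fin using (Fin; zero; suc; toℕ; punchOut; _<_)
open import Data.Fin.Properties using (_≟_; _<?_; <-cmp; all?; any?; *↔×; 2↔Bool; punchOut-injective; injective⇒≤)
open import Data.Nat as ℕ using (ℕ; zero; suc; _≡ᵇ_)
open import Data.Nat.DivMod using (_/_; _%_; _mod_)
open import Data.Nat.Properties using (1+n≰n)
open import Data.Product using (_×_; _,_; proj₁; proj₂; ∃; uncurry)
open import Data.Product.Function.NonDependent.Propositional using (_×-↔_)
open import Data.Product.Properties using (,-injective)
open import Data.Vec using (Vec; []; _∷_; lookup; map; replicate; uncons; zipWith)
open import Data.Vec.Properties using (≡-dec; zipWith-assoc; zipWith-comm; zipWith-identityˡ; zipWith-identityʳ)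
open import Function using (_∘_; id; _↔_; mk↔ₛ′; Inverse; Injection; Injective; Bijective)
open import Function.Consequences.Propositional using (strictlySurjective⇒surjective)
open import Function.Construct.Composition using (_↔-∘_)
open import Function.Construct.Identity using (↔-id)
open import Function.Construct.Symmetry using (↔-sym)
open import Function.Properties.Inverse using (↔⇒↣)
open import Level using (0ℓ)
open import Relation.Binary.Definitions using (tri<; tri≈; tri>)
open import Relation.Binary.PropositionalEquality
open import Relation.Nullary using (Dec; yes; no; contradiction)
open import Relation.Nullary.Decidable using (map′; from-yes; _×-dec_; _→-dec_)
open import Relation.Unary using (Decidable)

-- Pigeonhole principle on a finite set

injective⇒bijective : ∀ {n} (f : Fin n → Fin n) → Injective _≡_ _≡_ f → Bijective _≡_ _≡_ f
injective⇒bijective f inj = inj , strictlySurjective⇒surjective (surj f inj)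
  where
  surj : ∀ {n} (f : Fin n → Fin n) → Injective _≡_ _≡_ f → ∀ y → ∃ λ x → f x ≡ y
  surj {suc n} f inj y with any? (λ x → f x ≟ y)
  ... | yes hit = hit
  -- If `y` is missed, deleting it from the codomain leaves an injection of `Fin (suc n)` into
  -- `Fin n`.
  ... | no miss = contradiction (injective⇒≤ punched-injective) 1+n≰n
    where
    avoids : ∀ x → y ≢ f x
    avoids x eq = miss (x , sym eq)

    punched-injective : Injective _≡_ _≡_ (λ x → punchOut (avoids x))
    punched-injective {x} {x′} eq = inj (punchOut-injective (avoids x) (avoids x′) eq)

-- From difference matrices to MOLS

module _ {A : Set} {_∙_ : A → A → A} {ε : A} {_⁻¹ : A → A}
         (isGroup : IsGroup _≡_ _∙_ ε _⁻¹) where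

  private
    G : Group 0ℓ 0ℓ
    G = record { isGroup = isGroup }

  open IsGroup isGroup using (assoc)
  open GroupProperties G using (∙-cancelˡ; ⁻¹-anti-homo-∙; \\-leftDividesˡ)
  open ≡-Reasoning

  -- Pairs with `t < r` suffice, since exchanging the two rows inverts the quotient. Injectivity
  -- amounts to bijectivity once `C` and `A` have the same finite size.
  IsDifferenceMatrix : ∀ {m} {C : Set} → (Fin m → C → A) → Set
  IsDifferenceMatrix D = ∀ r t → t < r → Injective _≡_ _≡_ (λ c → D r c ∙ (D t c ⁻¹))

  right-translate-quotient : ∀ x y g → (x ∙ g) ∙ ((y ∙ g) ⁻¹) ≡ x ∙ (y ⁻¹)
  right-translate-quotient x y g = begin
    (x ∙ g) ∙ ((y ∙ g) ⁻¹)       ≡⟨ cong ((x ∙ g) ∙_) (⁻¹-anti-homo-∙ y g) ⟩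
    (x ∙ g) ∙ ((g ⁻¹) ∙ (y ⁻¹))  ≡⟨ assoc x g _ ⟩
    x ∙ (g ∙ ((g ⁻¹) ∙ (y ⁻¹)))  ≡⟨ cong (x ∙_) (\\-leftDividesˡ g (y ⁻¹)) ⟩
    x ∙ (y ⁻¹)                   ∎

  equal-translates⇒equal-quotients : ∀ {x x′ y y′ g g′} →
    x ∙ g ≡ x′ ∙ g′ → y ∙ g ≡ y′ ∙ g′ → x ∙ (y ⁻¹) ≡ x′ ∙ (y′ ⁻¹)
  equal-translates⇒equal-quotients {x} {x′} {y} {y′} {g} {g′} p q = begin
    x ∙ (y ⁻¹)                  ≡⟨ right-translate-quotient x y g ⟨
    (x ∙ g) ∙ ((y ∙ g) ⁻¹)      ≡⟨ cong₂ (λ u v → u ∙ (v ⁻¹)) p q ⟩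
    (x′ ∙ g′) ∙ ((y′ ∙ g′) ⁻¹)  ≡⟨ right-translate-quotient x′ y′ g′ ⟩
    x′ ∙ (y′ ⁻¹)                ∎

  differenceMatrix⇒MOLS : ∀ {k n} {C : Set} → A ↔ Fin n → C ↔ Fin n →
    (D : Fin (suc k) → C → A) → IsDifferenceMatrix D → MOLS k n
  differenceMatrix⇒MOLS {k} {n} {C} A↔Fin C↔Fin D isDM =
    (λ a → L a , rowBijective a , columnBijective a) , orthogonal
    where
    col : Fin n → C
    col = Inverse.from C↔Fin

    elt : Fin n → A
    elt = Inverse.from A↔Fin

    num : A → Fin n
    num = Inverse.to A↔Fin

    col-injective : Injective _≡_ _≡_ col
    col-injective = Injection.injective (↔⇒↣ (↔-sym C↔Fin))

    elt-injective : Injective _≡_ _≡_ elt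
    elt-injective = Injection.injective (↔⇒↣ (↔-sym A↔Fin))

    num-injective : Injective _≡_ _≡_ num
    num-injective = Injection.injective (↔⇒↣ A↔Fin)

    -- The group element by which column i has to be translated for its entry
    -- in row 0 to become j.
    shift : Fin n → Fin n → A
    shift i j = (D zero (col i) ⁻¹) ∙ elt j

    row₀ : ∀ i j → D zero (col i) ∙ shift i j ≡ elt j
    row₀ i j = \\-leftDividesˡ (D zero (col i)) (elt j)

    -- The orthogonal array has `k + 2` rows: the index `i` of the base column and row 0 serve as
    -- coordinates, and each other row becomes a square.
    L : Fin k → Fin n → Fin n → Fin n
    L a i j = num (D (suc a) (col i) ∙ shift i j)

    rowInjective : ∀ a i → Injective _≡_ _≡_ (L a i)
    rowInjective a i eq =
      elt-injective (∙-cancelˡ _ _ _ (∙-cancelˡ _ _ _ (num-injective eq)))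

    rowBijective : ∀ a i → Bijective _≡_ _≡_ (L a i)
    rowBijective a i = injective⇒bijective (L a i) (rowInjective a i)

    columnBijective : ∀ a j → Bijective _≡_ _≡_ (λ i → L a i j)
    columnBijective a j = injective⇒bijective (λ i → L a i j) λ {i} {i′} eq →
      -- Row 0 of a translated column holds `elt j`, so for fixed `j` equal entries of the square
      -- mean agreement in the two rows `suc a` and 0.
      col-injective (isDM (suc a) zero ℕ.z<s
        (equal-translates⇒equal-quotients (num-injective eq)
          (trans (row₀ i j) (sym (row₀ i′ j)))))

    determined : ∀ a b → b < a → ∀ {i i′ j j′} →
      L a i j ≡ L a i′ j′ → L b i j ≡ L b i′ j′ → (i , j) ≡ (i′ , j′)
    determined a b b<a {i} p q
      -- Agreement in two rows forces the same base column; then one row of a square fixes `j`.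
      with refl ← col-injective (isDM (suc a) (suc b) (ℕ.s<s b<a)
             (equal-translates⇒equal-quotients (num-injective p) (num-injective q)))
      = cong (i ,_) (rowInjective a i p)

    orthogonal : ∀ a b → a ≢ b →
      Injective _≡_ _≡_ (λ (p : Fin n × Fin n) → let (i , j) = p in (L a i j , L b i j))
    orthogonal a b a≢b eq with <-cmp a b | ,-injective eq
    ... | tri< a<b _ _ | p , q = determined b a a<b q p
    ... | tri≈ _ a≡b _ | _     = contradiction a≡b a≢b
    ... | tri> _ _ b<a | p , q = determined a b b<a p q

-- The group Z₃ × Z₂ᵐ

×-isGroup : ∀ {A B : Set} {_∙_ : A → A → A} {ε : A} {_⁻¹ : A → A} {_⋆_ : B → B → B} {e : B} {inv : B → B} →
  IsGroup _≡_ _∙_ ε _⁻¹ → IsGroup _≡_ _⋆_ e inv →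
  IsGroup _≡_ (λ (a , b) (a′ , b′) → (a ∙ a′ , b ⋆ b′)) (ε , e) (λ (a , b) → (a ⁻¹ , inv b))
×-isGroup isG isH = record
  { isMonoid = record
    { isSemigroup = record
      { isMagma = record { isEquivalence = isEquivalence ; ∙-cong = λ { refl refl → refl } }
      ; assoc   = λ (a , b) (a′ , b′) (a″ , b″) → cong₂ _,_ (G.assoc a a′ a″) (H.assoc b b′ b″)
      }
    ; identity = (λ (a , b) → cong₂ _,_ (G.identityˡ a) (H.identityˡ b))
               , (λ (a , b) → cong₂ _,_ (G.identityʳ a) (H.identityʳ b))
    }
  ; inverse = (λ (a , b) → cong₂ _,_ (G.inverseˡ a) (H.inverseˡ b))
            , (λ (a , b) → cong₂ _,_ (G.inverseʳ a) (H.inverseʳ b))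
  ; ⁻¹-cong = λ { refl → refl }
  }
  where
  module G = IsGroup isG
  module H = IsGroup isH

infixl 6 _+₃_ _⊕_

_+₃_ : Fin 3 → Fin 3 → Fin 3
x +₃ y = (toℕ x ℕ.+ toℕ y) mod 3

-₃_ : Fin 3 → Fin 3
-₃ x = (3 ℕ.∸ toℕ x) mod 3

+₃-isGroup : IsGroup _≡_ _+₃_ zero -₃_
+₃-isGroup = record
  { isMonoid = record
    { isSemigroup = record
      { isMagma = record { isEquivalence = isEquivalence ; ∙-cong = cong₂ _+₃_ }
      ; assoc   = from-yes (all? λ x → all? λ y → all? λ z → (x +₃ y) +₃ z ≟ x +₃ (y +₃ z))
      }
    ; identity = from-yes (all? λ x → zero +₃ x ≟ x) , from-yes (all? λ x → x +₃ zero ≟ x)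
    }
  ; inverse = from-yes (all? λ x → (-₃ x) +₃ x ≟ zero) , from-yes (all? λ x → x +₃ (-₃ x) ≟ zero)
  ; ⁻¹-cong = cong -₃_
  }

Bits : ℕ → Set
Bits = Vec Bool

_⊕_ : ∀ {m} → Bits m → Bits m → Bits m
_⊕_ = zipWith _xor_

𝟎 : ∀ {m} → Bits m
𝟎 = replicate _ false

⊕-self : ∀ {m} (x : Bits m) → x ⊕ x ≡ 𝟎
⊕-self []      = refl
⊕-self (a ∷ x) = cong₂ _∷_ (Bool.xor-same a) (⊕-self x)

⊕-isGroup : ∀ {m} → IsGroup _≡_ (_⊕_ {m}) 𝟎 id
⊕-isGroup = record
  { isMonoid = record
    { isSemigroup = record
      { isMagma = record { isEquivalence = isEquivalence ; ∙-cong = cong₂ _⊕_ }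
      ; assoc   = zipWith-assoc Bool.xor-assoc
      }
    ; identity = zipWith-identityˡ Bool.xor-identityˡ , zipWith-identityʳ Bool.xor-identityʳ
    }
  ; inverse = ⊕-self , ⊕-self
  ; ⁻¹-cong = id
  }

⊕-group : ℕ → Group 0ℓ 0ℓ
⊕-group m = record { isGroup = ⊕-isGroup {m} }

⊕-commutativeSemigroup : ℕ → CommutativeSemigroup 0ℓ 0ℓ
⊕-commutativeSemigroup m = record
  { isCommutativeSemigroup = record
    { isSemigroup = IsGroup.isSemigroup (⊕-isGroup {m})
    ; comm        = zipWith-comm Bool.xor-comm
    }
  }

module _ {m : ℕ} where
  open CommutativeSemigroupProperties (⊕-commutativeSemigroup m) public
    using () renaming (interchange to ⊕-interchange)
  open GroupProperties (⊕-group m) public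
    using () renaming (inverseˡ-unique to ⊕≡𝟎⇒≡)

-- Linear maps over Z₂ and enumeration of bit vectors

linear : ∀ {k m} → Vec (Bits m) k → Bits k → Bits m
linear []       []      = 𝟎
linear (y ∷ ys) (a ∷ v) = (if a then y else 𝟎) ⊕ linear ys v

linear-⊕ : ∀ {k m} (ys : Vec (Bits m) k) v w → linear ys (v ⊕ w) ≡ linear ys v ⊕ linear ys w
linear-⊕ []       []      []      = sym (⊕-self 𝟎)
linear-⊕ (y ∷ ys) (a ∷ v) (b ∷ w) = begin
  scale (a xor b) ⊕ linear ys (v ⊕ w)                ≡⟨ cong₂ _⊕_ (scale-xor a b) (linear-⊕ ys v w) ⟩
  (scale a ⊕ scale b) ⊕ (linear ys v ⊕ linear ys w)  ≡⟨ ⊕-interchange (scale a) (scale b) _ _ ⟩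
  (scale a ⊕ linear ys v) ⊕ (scale b ⊕ linear ys w)  ∎
  where
  open ≡-Reasoning

  scale : Bool → Bits _
  scale a = if a then y else 𝟎

  scale-xor : ∀ a b → scale (a xor b) ≡ scale a ⊕ scale b
  scale-xor false b     = sym (zipWith-identityˡ Bool.xor-identityˡ (scale b))
  scale-xor true  false = sym (zipWith-identityʳ Bool.xor-identityʳ y)
  scale-xor true  true  = sym (⊕-self y)

uncons↔ : ∀ {m} → Bits (suc m) ↔ (Bool × Bits m)
uncons↔ = mk↔ₛ′ uncons (uncurry _∷_) (λ _ → refl) (λ { (a ∷ v) → refl })

Bits↔Fin : ∀ m → Bits m ↔ Fin (2 ℕ.^ m)
Bits↔Fin zero    = mk↔ₛ′ (λ _ → zero) (λ _ → []) (λ { zero → refl }) (λ { [] → refl })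
Bits↔Fin (suc m) = ↔-sym *↔× ↔-∘ ((↔-sym 2↔Bool ×-↔ Bits↔Fin m) ↔-∘ uncons↔)

allBits? : ∀ {m} {P : Bits m → Set} → Decidable P → Dec (∀ v → P v)
allBits? {zero}  P? = map′ (λ { p [] → p }) (λ f → f []) (P? [])
allBits? {suc m} P? = map′
  (λ { (p , q) (false ∷ v) → p v ; (p , q) (true ∷ v) → q v })
  (λ f → (λ v → f (false ∷ v)) , (λ v → f (true ∷ v)))
  (allBits? (P? ∘ (false ∷_)) ×-dec allBits? (P? ∘ (true ∷_)))

-- Difference matrices developed from base columns

module DevelopedMatrix {k l m n} (b : Fin n → Fin l → Fin 3) (c : Fin n → Fin l → Bits m)
                       (Y : Fin n → Vec (Bits m) k) where

  D : Fin n → Fin l × Bits k → Fin 3 × Bits m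
  D r (s , v) = b r s , c r s ⊕ linear (Y r) v

  -- By linearity a single `w` replaces a pair `v`, `v′`. For `s = s′` the left side is `𝟎`, so the
  -- clause `w ≡ 𝟎` says that `Y r ⊕ Y t` has trivial kernel.
  CosetsDisjoint : Fin n → Fin n → Set
  CosetsDisjoint r t = ∀ s s′ → b r s +₃ (-₃ b t s) ≡ b r s′ +₃ (-₃ b t s′) →
    ∀ w → (c r s ⊕ c t s) ⊕ (c r s′ ⊕ c t s′) ≡ linear (Y r) w ⊕ linear (Y t) w →
    s ≡ s′ × w ≡ 𝟎

  cosetsDisjoint? : ∀ r t → Dec (CosetsDisjoint r t)
  cosetsDisjoint? r t = all? λ s → all? λ s′ → (_ ≟ _) →-dec
    allBits? λ w → ≡-dec Bool._≟_ _ _ →-dec (s ≟ s′ ×-dec ≡-dec Bool._≟_ w 𝟎)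

  isDifferenceMatrix : (∀ r t → t < r → CosetsDisjoint r t) →
    IsDifferenceMatrix (×-isGroup +₃-isGroup (⊕-isGroup {m})) D
  isDifferenceMatrix disjoint r t t<r {s , v} {s′ , v′} eq =
    cong₂ _,_ (proj₁ s≡s′×v⊕v′≡𝟎) (⊕≡𝟎⇒≡ v v′ (proj₂ s≡s′×v⊕v′≡𝟎))
    where
    open ≡-Reasoning

    d : Fin l → Bits m
    d s = c r s ⊕ c t s

    Z : Bits k → Bits m
    Z v = linear (Y r) v ⊕ linear (Y t) v

    Z-⊕ : ∀ v w → Z (v ⊕ w) ≡ Z v ⊕ Z w
    Z-⊕ v w = trans (cong₂ _⊕_ (linear-⊕ (Y r) v w) (linear-⊕ (Y t) v w))
                    (⊕-interchange (linear (Y r) v) _ _ _)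

    d⊕Z : d s ⊕ Z v ≡ d s′ ⊕ Z v′
    d⊕Z = begin
      d s ⊕ Z v                                                ≡⟨ ⊕-interchange (c r s) _ _ _ ⟩
      -- Inversion in Z₂ᵐ is `id`, so the quotient in `eq` is a sum here.
      (c r s ⊕ linear (Y r) v) ⊕ (c t s ⊕ linear (Y t) v)      ≡⟨ proj₂ (,-injective eq) ⟩
      (c r s′ ⊕ linear (Y r) v′) ⊕ (c t s′ ⊕ linear (Y t) v′)  ≡⟨ ⊕-interchange (c r s′) _ _ _ ⟩
      d s′ ⊕ Z v′                                              ∎

    d⊕d≡Z : d s ⊕ d s′ ≡ Z (v ⊕ v′)
    d⊕d≡Z = ⊕≡𝟎⇒≡ _ _ (begin
      (d s ⊕ d s′) ⊕ Z (v ⊕ v′)      ≡⟨ cong ((d s ⊕ d s′) ⊕_) (Z-⊕ v v′) ⟩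
      (d s ⊕ d s′) ⊕ (Z v ⊕ Z v′)    ≡⟨ ⊕-interchange (d s) _ _ _ ⟩
      (d s ⊕ Z v) ⊕ (d s′ ⊕ Z v′)    ≡⟨ cong (_⊕ (d s′ ⊕ Z v′)) d⊕Z ⟩
      (d s′ ⊕ Z v′) ⊕ (d s′ ⊕ Z v′)  ≡⟨ ⊕-self _ ⟩
      𝟎                              ∎)

    s≡s′×v⊕v′≡𝟎 : s ≡ s′ × v ⊕ v′ ≡ 𝟎
    s≡s′×v⊕v′≡𝟎 = disjoint r t t<r s s′ (proj₁ (,-injective eq)) (v ⊕ v′) d⊕d≡Z

-- The explicit matrix and its verification

binary : ∀ m → ℕ → Bits m
binary zero    n = []
binary (suc m) n = (n % 2 ≡ᵇ 1) ∷ binary m (n / 2)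

-- The entry 32 b + c stands for (b , binary 5 c).  The table was found by computer
-- under the assumption of a symmetry group Z₃² that is regular on the rows and
-- on the first 9 base columns and permutes the last 3: with rows i = (i₀ , i₁)
-- and columns s = (s₀ , s₁) in lexicographic order, b i s = f (s − i) + i₀ s₁
-- and c i s = P i (γ (s − i)) for a representation P of Z₃² on Z₂⁵; in the last
-- columns b i t = i₁ + i₀ t and c i t = P i (δ (t − i₁)).
table : Vec (Vec ℕ 12) 9
table =
  ( 1 ∷ 29 ∷ 16 ∷ 57 ∷ 17 ∷ 49 ∷ 38 ∷ 77 ∷ 27 ∷ 17 ∷ 13 ∷  7 ∷ []) ∷
  (16 ∷  3 ∷ 23 ∷ 51 ∷ 63 ∷ 19 ∷ 30 ∷ 41 ∷ 71 ∷ 42 ∷ 51 ∷ 39 ∷ []) ∷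
  (26 ∷ 16 ∷  2 ∷ 18 ∷ 50 ∷ 54 ∷ 74 ∷ 21 ∷ 47 ∷ 74 ∷ 77 ∷ 82 ∷ []) ∷
  (43 ∷  6 ∷ 93 ∷  2 ∷ 54 ∷ 80 ∷ 62 ∷ 50 ∷ 18 ∷ 18 ∷ 38 ∷ 73 ∷ []) ∷
  (23 ∷ 78 ∷ 41 ∷ 16 ∷ 33 ∷ 89 ∷ 49 ∷ 85 ∷ 81 ∷ 47 ∷ 81 ∷  9 ∷ []) ∷
  (79 ∷ 58 ∷  5 ∷ 31 ∷ 48 ∷ 67 ∷ 19 ∷ 83 ∷ 27 ∷ 79 ∷  6 ∷ 51 ∷ []) ∷
  (55 ∷ 83 ∷ 83 ∷ 45 ∷ 43 ∷ 54 ∷  3 ∷ 91 ∷ 48 ∷ 19 ∷ 75 ∷ 46 ∷ []) ∷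
  (50 ∷ 26 ∷ 50 ∷ 25 ∷  7 ∷ 14 ∷ 16 ∷ 66 ∷ 62 ∷ 37 ∷ 18 ∷ 78 ∷ []) ∷
  (17 ∷ 17 ∷ 93 ∷ 69 ∷ 95 ∷ 74 ∷ 21 ∷ 80 ∷ 33 ∷ 69 ∷ 43 ∷ 17 ∷ []) ∷ []

-- Row `r` encodes the images of the standard basis of Z₂³ under `Y r`.
generators : Vec (Vec ℕ 3) 9
generators =
  (19 ∷ 12 ∷ 14 ∷ []) ∷
  (18 ∷  4 ∷  5 ∷ []) ∷
  (17 ∷  8 ∷ 11 ∷ []) ∷
  ( 4 ∷ 21 ∷  7 ∷ []) ∷
  ( 8 ∷ 27 ∷ 10 ∷ []) ∷
  (12 ∷ 30 ∷ 13 ∷ []) ∷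
  (26 ∷ 18 ∷  9 ∷ []) ∷
  (29 ∷ 17 ∷ 15 ∷ []) ∷
  (23 ∷ 19 ∷  6 ∷ []) ∷ []

open DevelopedMatrix {k = 3} {m = 5}
  (λ r s → (lookup (lookup table r) s / 32) mod 3)
  -- `binary 5` keeps only the five low bits, so it reads c off 32 b + c.
  (λ r s → binary 5 (lookup (lookup table r) s))
  (λ r → map (binary 5) (lookup generators r))

cosetsDisjoint : ∀ r t → t < r → CosetsDisjoint r t
-- An exhaustive finite check over the 36 pairs of rows, by evaluation.
cosetsDisjoint = from-yes (all? λ r → all? λ t → (t <? r) →-dec cosetsDisjoint? r t)

theorem5 : MOLS 8 96
theorem5 = differenceMatrix⇒MOLS (×-isGroup +₃-isGroup ⊕-isGroup)
  (↔-sym (*↔× {3} {32}) ↔-∘ (↔-id _ ×-↔ Bits↔Fin 5))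
  (↔-sym (*↔× {12} {8}) ↔-∘ (↔-id _ ×-↔ Bits↔Fin 3))
  D (isDifferenceMatrix cosetsDisjoint)
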